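{- For a positive integer $N$, let $H_3(N)$ be the number of tuples $(a_0,a_1,a_2,a_3)$ of integers with $0\le a_0\le N$, $1\le a_i\le N$ for $i=1,2,3$, $\gcd(a_0,a_1,a_2,a_3)=1$, and $H(a_0;a_1,a_2,a_3)\subset\mathcal{S}$. Then $H_3(N)\gg N^{1/8}$, i.e. there exist constants $c>0$ and $N_0$ such that $H_3(N)\ge c\,N^{1/8}$ for all $N\ge N_0$.
   Context: $\mathcal{S}=\{n^2 : n\in\mathbb{N}\}$ is the set of integer squares ($\mathbb{N}$ contains $0$). The Hilbert cube of dimension $3$ is $H(a_0;a_1,a_2,a_3)=\{a_0+\varepsilon_1a_1+\varepsilon_2a_2+\varepsilon_3a_3 : \varepsilon_i\in\{0,1\}\}$. A Hilbert cube is called reduced if $\gcd(a_0,a_1,a_2,a_3)=1$. -}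

module Defs where

open import Data.Fin using (Fin; toℕ)
import Data.Fin.Properties as Fin
open import Data.Integer using (+_)
open import Data.List using (List; length; filter; upTo; cartesianProduct)
open import Data.Nat using (ℕ; suc; _+_; _*_; _^_; _≤_; _≤?_; _≟_; z≤n; s≤s)
open import Data.Nat.GCD using (gcd)
open import Data.Nat.Properties using (anyUpTo?; m≤m*n)
open import Data.Product using (∃-syntax; _×_; _,_)
open import Data.Rational as ℚ using (ℚ)
open import Level using (0ℓ)
open import Relation.Binary.PropositionalEquality using (_≡_; refl)
open import Relation.Nullary using (Dec)
open import Relation.Nullary.Decidable using (map′; _×-dec_)
open import Relation.Unary using (Pred; Decidable; _⊆_)
import Algebra.Definitions.RawSemiring ℚ.+-*-rawSemiring as ℚ-Power

𝒮 : Pred ℕ 0ℓ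
𝒮 x = ∃[ n ] x ≡ n ^ 2

H : (a₀ a₁ a₂ a₃ : ℕ) → Pred ℕ 0ℓ
H a₀ a₁ a₂ a₃ x =
  ∃[ ε₁ ] ∃[ ε₂ ] ∃[ ε₃ ]
    x ≡ a₀ + toℕ {2} ε₁ * a₁ + toℕ {2} ε₂ * a₂ + toℕ {2} ε₃ * a₃

Reduced : (a₀ a₁ a₂ a₃ : ℕ) → Set
Reduced a₀ a₁ a₂ a₃ = gcd a₀ (gcd a₁ (gcd a₂ a₃)) ≡ 1

-- All entries are constrained to be nonnegative, so integer tuples are
-- represented by tuples of naturals (and 0 ≤ a₀ is automatic).
Quadruple : Set
Quadruple = ℕ × ℕ × ℕ × ℕ

Admissible : ℕ → Pred Quadruple 0ℓ
Admissible N (a₀ , a₁ , a₂ , a₃) =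
  a₀ ≤ N ×
  (1 ≤ a₁ × a₁ ≤ N) ×
  (1 ≤ a₂ × a₂ ≤ N) ×
  (1 ≤ a₃ × a₃ ≤ N) ×
  Reduced a₀ a₁ a₂ a₃ ×
  H a₀ a₁ a₂ a₃ ⊆ 𝒮

n≤n² : ∀ n → n ≤ n ^ 2
n≤n² 0       = z≤n
n≤n² (suc n) = m≤m*n (suc n) (suc n ^ 1)

𝒮? : Decidable 𝒮
𝒮? x = map′
  (λ { (n , _ , eq) → n , eq })
  (λ { (n , refl) → n , s≤s (n≤n² n) , refl })
  (anyUpTo? (λ n → x ≟ n ^ 2) (suc x))

H⊆𝒮? : ∀ a₀ a₁ a₂ a₃ → Dec (H a₀ a₁ a₂ a₃ ⊆ 𝒮)
H⊆𝒮? a₀ a₁ a₂ a₃ = map′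
  (λ { all-squares (ε₁ , ε₂ , ε₃ , refl) → all-squares ε₁ ε₂ ε₃ })
  (λ H⊆𝒮 ε₁ ε₂ ε₃ → H⊆𝒮 (ε₁ , ε₂ , ε₃ , refl))
  (Fin.all? λ ε₁ → Fin.all? λ ε₂ → Fin.all? λ ε₃ →
    𝒮? (a₀ + toℕ {2} ε₁ * a₁ + toℕ {2} ε₂ * a₂ + toℕ {2} ε₃ * a₃))

Admissible? : ∀ N → Decidable (Admissible N)
Admissible? N (a₀ , a₁ , a₂ , a₃) =
  (a₀ ≤? N) ×-dec
  ((1 ≤? a₁) ×-dec (a₁ ≤? N)) ×-dec
  ((1 ≤? a₂) ×-dec (a₂ ≤? N)) ×-dec
  ((1 ≤? a₃) ×-dec (a₃ ≤? N)) ×-dec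
  (gcd a₀ (gcd a₁ (gcd a₂ a₃)) ≟ 1) ×-dec
  H⊆𝒮? a₀ a₁ a₂ a₃

-- Lists every element of {0,…,N}⁴ exactly once; all admissible quadruples
-- lie in this box.
box : ℕ → List Quadruple
box N = cartesianProduct I (cartesianProduct I (cartesianProduct I I))
  where
  I : List ℕ
  I = upTo (suc N)

H₃ : ℕ → ℕ
H₃ N = length (filter (Admissible? N) (box N))

fromℕ : ℕ → ℚ
fromℕ n = + n ℚ./ 1

-- For c ≥ 0 and k ≥ 1, the real inequality  c · N^(1/k) ≤ h.  Both sides are
-- nonnegative and N^(1/k) is the nonnegative real whose k-th power is N, so
-- it is expressed, without reals, by comparing k-th powers.
_·_^[1/_]≤_ : ℚ → ℕ → ℕ → ℕ → Set
c · N ^[1/ k ]≤ h = (c ℚ-Power.^ k) ℚ.* fromℕ N ℚ.≤ fromℕ h ℚ-Power.^ k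

{-# OPTIONS --safe #-}
module Submission where

-- A cube with a₁ = a₂ = d lies in the squares as soon as a₀ and a₀ + a₃ both
-- begin three-term progressions of squares with difference d.  Put m = n + k;
-- the Pythagorean triple (m² − n², 2mn, m² + n²) gives the progression
-- (m² − 2mn − n²)², (m² + n²)², (m² + 2mn − n²)² with difference 4mn(m² − n²).
-- Diophantus' right triangles of equal area, (n , k) = (u(u+2) , u+3) and
-- (2u+3 , u(u+1)), give two such progressions with a common difference.  Their
-- terms have degree at most 8 in u, whence the exponent 1/8.  A common divisor
-- of the aᵢ divides both d and (m² + n²)², which are coprime when m and n are
-- coprime of opposite parity.

open import Defs
open import Data.Fin as Fin using (Fin; toℕ)
open import Data.Fin.Properties as Fin using (toℕ<n; toℕ-injective)
open import Data.Integer as ℤ using (+_)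
import Data.Integer.Properties as ℤ
open import Data.List using (List; length; lookup)
open import Data.List.Membership.Propositional using (_∈_)
open import Data.List.Membership.Propositional.Properties
  using (∈-upTo⁺; ∈-cartesianProduct⁺; ∈-filter⁺)
open import Data.List.Relation.Unary.Any using (index)
open import Data.List.Relation.Unary.Any.Properties using (lookup-index)
open import Data.Nat renaming (_<_ to _<ℕ_)
open import Data.Nat.Coprimality as Coprime using (Coprime; coprime-divisor)
open import Data.Nat.Divisibility
open import Data.Nat.GCD using (gcd; gcd[m,n]∣m; gcd[m,n]∣n)
open import Data.Nat.Properties
open import Data.Nat.Tactic.RingSolver using (solve-∀)
open import Data.Product using (_×_; _,_; ∃-syntax; proj₁; proj₂)
open import Data.Rational as ℚ using (ℚ; 0ℚ; _<_)
import Data.Rational.Properties as ℚ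
import Data.Rational.Unnormalised as ℚᵘ
import Data.Rational.Unnormalised.Properties as ℚᵘ
open import Data.Sum using (inj₁; inj₂)
open import Function using (_∘_)
open import Relation.Binary.Definitions using (tri<; tri≈; tri>)
open import Relation.Binary.PropositionalEquality
open import Relation.Nullary using (contradiction)
open import Relation.Unary using (_⊆_)
import Algebra.Definitions.RawSemiring ℚ.+-*-rawSemiring as ℚ-Power
open import Algebra.Bundles using (CommutativeRing)
import Algebra.Properties.CommutativeSemiring.Exp
  (CommutativeRing.commutativeSemiring ℚ.+-*-commutativeRing) as ℚ-Exp

-- Coprimality of products and linear combinations.

coprime-*ʳ : ∀ {a b c} → Coprime a b → Coprime a c → Coprime a (b * c)
coprime-*ʳ {a} {b} {c} a⊥b a⊥c {d} (d∣a , d∣bc) = a⊥c (d∣a , coprime-divisor d⊥b d∣bc)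
  where
  d⊥b : Coprime d b
  d⊥b (e∣d , e∣b) = a⊥b (∣-trans e∣d d∣a , e∣b)

coprime-*ˡ : ∀ {a b c} → Coprime a c → Coprime b c → Coprime (a * b) c
coprime-*ˡ a⊥c b⊥c = Coprime.sym (coprime-*ʳ (Coprime.sym a⊥c) (Coprime.sym b⊥c))

coprime-*+ : ∀ {a b} c → Coprime a b → Coprime (c * b + a) b
coprime-*+ c a⊥b (d∣cb+a , d∣b) = a⊥b (∣m+n∣m⇒∣n d∣cb+a (∣n⇒∣m*n c d∣b) , d∣b)

-- Three squares in arithmetic progression.

∣m-n∣²+2mn≡m²+n² : ∀ m n → ∣ m - n ∣ * ∣ m - n ∣ + 2 * (m * n) ≡ m * m + n * n
∣m-n∣²+2mn≡m²+n² zero    n       = +-identityʳ (n * n)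
∣m-n∣²+2mn≡m²+n² (suc m) zero    = cong (λ a → suc m * suc m + 2 * a) (*-zeroʳ m)
∣m-n∣²+2mn≡m²+n² (suc m) (suc n) = begin
  d² + 2 * (suc m * suc n)             ≡⟨ lhs d² m n ⟩
  d² + 2 * (m * n) + 2 * (1 + m + n)   ≡⟨ cong (_+ 2 * (1 + m + n)) (∣m-n∣²+2mn≡m²+n² m n) ⟩
  m * m + n * n + 2 * (1 + m + n)      ≡⟨ rhs m n ⟩
  suc m * suc m + suc n * suc n        ∎
  where
  open ≡-Reasoning
  d² = ∣ m - n ∣ * ∣ m - n ∣
  lhs : ∀ d² m n → d² + 2 * ((1 + m) * (1 + n)) ≡ d² + 2 * (m * n) + 2 * (1 + m + n)
  lhs = solve-∀
  rhs : ∀ m n → m * m + n * n + 2 * (1 + m + n) ≡ (1 + m) * (1 + m) + (1 + n) * (1 + n)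
  rhs = solve-∀

-- With m = n + k these are ∣m² - 2mn - n²∣, m² + n², m² + 2mn - n², the leg m² - n², half of the
-- leg 2mn, and four times the area of the triangle. Writing m as n + k leaves `side` as the only
-- expression with a difference.
side middle large leg₁ leg₂/2 step : ℕ → ℕ → ℕ
side   n k = ∣ 2 * (n * n) - k * k ∣
middle n k = 2 * (n * n) + 2 * (n * k) + k * k
large  n k = 2 * (n * n) + 4 * (n * k) + k * k
leg₁   n k = k * (2 * n + k)
leg₂/2 n k = n * (n + k)
step   n k = 4 * leg₂/2 n k * leg₁ n k

middle²≡side²+step : ∀ n k → middle n k * middle n k ≡ side n k * side n k + step n k
-- Adding twice the product of 2n² and k² turns the square of their absolute difference into a sum
-- of squares, so that a polynomial identity remains.
middle²≡side²+step n k = +-cancelʳ-≡ (2 * (2 * (n * n) * (k * k))) _ _ (begin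
  middle n k * middle n k + 2 * (2 * (n * n) * (k * k))
    ≡⟨ identity n k ⟩
  2 * (n * n) * (2 * (n * n)) + k * k * (k * k) + step n k
    ≡⟨ cong (_+ step n k) (∣m-n∣²+2mn≡m²+n² (2 * (n * n)) (k * k)) ⟨
  side n k * side n k + 2 * (2 * (n * n) * (k * k)) + step n k
    ≡⟨ swap (side n k * side n k) _ (step n k) ⟩
  side n k * side n k + step n k + 2 * (2 * (n * n) * (k * k)) ∎)
  where
  open ≡-Reasoning
  identity : ∀ n k →
    (2 * (n * n) + 2 * (n * k) + k * k) * (2 * (n * n) + 2 * (n * k) + k * k)
      + 2 * (2 * (n * n) * (k * k))
    ≡ 2 * (n * n) * (2 * (n * n)) + k * k * (k * k) + 4 * (n * (n + k)) * (k * (2 * n + k))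
  identity = solve-∀
  swap : ∀ a b c → a + b + c ≡ a + c + b
  swap = solve-∀

large²≡middle²+step : ∀ n k → large n k * large n k ≡ middle n k * middle n k + step n k
large²≡middle²+step = identity
  where
  identity : ∀ n k →
    (2 * (n * n) + 4 * (n * k) + k * k) * (2 * (n * n) + 4 * (n * k) + k * k)
    ≡ (2 * (n * n) + 2 * (n * k) + k * k) * (2 * (n * n) + 2 * (n * k) + k * k)
      + 4 * (n * (n + k)) * (k * (2 * n + k))
  identity = solve-∀

-- `middle` is the hypotenuse, so its square is x² + 4z² with x odd and coprime to z; hence it is
-- coprime to each of the factors 2, 2, z, x of `step`.
middle²⊥step : ∀ {n k} → Coprime n k → Coprime k 2 → Coprime (middle n k * middle n k) (step n k)
middle²⊥step {n} {k} n⊥k k⊥2 =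
  coprime-*ʳ (coprime-*ʳ (coprime-*ʳ {b = 2} {c = 2} B²⊥2 B²⊥2) B²⊥z) B²⊥x
  where
  x = leg₁ n k
  z = leg₂/2 n k

  k⊥n+k : Coprime k (n + k)
  k⊥n+k = Coprime.sym (subst (λ a → Coprime a k)
    (trans (cong (_+ n) (*-identityˡ k)) (+-comm k n)) (coprime-*+ 1 n⊥k))

  2n+k⊥n+k : Coprime (2 * n + k) (n + k)
  2n+k⊥n+k = subst (λ a → Coprime a (n + k)) (eq n k)
    (coprime-*+ 1 (Coprime.sym (subst (λ a → Coprime a n) (eq′ n k) (coprime-*+ 1 (Coprime.sym n⊥k)))))
    where
    eq : ∀ n k → 1 * (n + k) + n ≡ 2 * n + k
    eq = solve-∀
    eq′ : ∀ n k → 1 * n + k ≡ n + k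
    eq′ = solve-∀

  x⊥z : Coprime x z
  x⊥z = coprime-*ˡ
    (coprime-*ʳ (Coprime.sym n⊥k) k⊥n+k)
    (coprime-*ʳ (coprime-*+ 2 (Coprime.sym n⊥k)) 2n+k⊥n+k)

  x⊥2 : Coprime x 2
  x⊥2 = coprime-*ˡ k⊥2 (subst (λ a → Coprime (a + k) 2) (*-comm n 2) (coprime-*+ n k⊥2))

  B² = middle n k * middle n k

  B²≡4z²+x² : (4 * z) * z + x * x ≡ B²
  B²≡4z²+x² = identity n k
    where
    identity : ∀ n k →
      (4 * (n * (n + k))) * (n * (n + k)) + (k * (2 * n + k)) * (k * (2 * n + k))
      ≡ (2 * (n * n) + 2 * (n * k) + k * k) * (2 * (n * n) + 2 * (n * k) + k * k)
    identity = solve-∀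

  B²⊥z : Coprime B² z
  B²⊥z = subst (λ a → Coprime a z) B²≡4z²+x² (coprime-*+ (4 * z) (coprime-*ˡ x⊥z x⊥z))

  B²⊥2 : Coprime B² 2
  B²⊥2 = subst (λ a → Coprime a 2)
    (trans (cong (_+ x * x) (eq z)) B²≡4z²+x²)
    (coprime-*+ (2 * z * z) (coprime-*ˡ x⊥2 x⊥2))
    where
    eq : ∀ z → 2 * z * z * 2 ≡ 4 * z * z
    eq = solve-∀

  B²⊥x : Coprime B² x
  B²⊥x = subst (λ a → Coprime a x)
    (trans (+-comm (x * x) _) B²≡4z²+x²)
    (coprime-*+ x (coprime-*ˡ (coprime-*ˡ (coprime-*ˡ {2} {2} 2⊥x 2⊥x) z⊥x) z⊥x))
    where
    2⊥x = Coprime.sym x⊥2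
    z⊥x = Coprime.sym x⊥z

-- Cubes from two progressions with a common difference.

square∈𝒮 : ∀ x {y} → y ≡ x * x → 𝒮 y
square∈𝒮 x y≡x² = x , trans y≡x² (cong (x *_) (sym (*-identityʳ x)))

two-progressions⇒H⊆𝒮 : ∀ {a d b} →
  𝒮 a → 𝒮 (a + d) → 𝒮 (a + d + d) →
  𝒮 (a + b) → 𝒮 (a + b + d) → 𝒮 (a + b + d + d) →
  H a d d b ⊆ 𝒮
two-progressions⇒H⊆𝒮 {a} {d} {b} s₀ s₁ s₂ t₀ t₁ t₂ (ε₁ , ε₂ , ε₃ , refl) = vertex ε₁ ε₂ ε₃
  where
  -- The right-hand sides are the normal forms of the vertices: `1 * d` unfolds to `d + 0` and
  -- `0 * d` to `0`.
  e₀₀₀ : ∀ a → a ≡ a + 0 + 0 + 0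
  e₀₀₀ = solve-∀
  e₀₀₁ : ∀ a b → a + b ≡ a + 0 + 0 + (b + 0)
  e₀₀₁ = solve-∀
  e₀₁₀ : ∀ a d → a + d ≡ a + 0 + (d + 0) + 0
  e₀₁₀ = solve-∀
  e₀₁₁ : ∀ a d b → a + b + d ≡ a + 0 + (d + 0) + (b + 0)
  e₀₁₁ = solve-∀
  e₁₀₀ : ∀ a d → a + d ≡ a + (d + 0) + 0 + 0
  e₁₀₀ = solve-∀
  e₁₀₁ : ∀ a d b → a + b + d ≡ a + (d + 0) + 0 + (b + 0)
  e₁₀₁ = solve-∀
  e₁₁₀ : ∀ a d → a + d + d ≡ a + (d + 0) + (d + 0) + 0
  e₁₁₀ = solve-∀
  e₁₁₁ : ∀ a d b → a + b + d + d ≡ a + (d + 0) + (d + 0) + (b + 0)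
  e₁₁₁ = solve-∀

  vertex : ∀ ε₁ ε₂ ε₃ → 𝒮 (a + toℕ {2} ε₁ * d + toℕ {2} ε₂ * d + toℕ {2} ε₃ * b)
  vertex Fin.zero           Fin.zero           Fin.zero           = subst 𝒮 (e₀₀₀ a) s₀
  vertex Fin.zero           Fin.zero           (Fin.suc Fin.zero) = subst 𝒮 (e₀₀₁ a b) t₀
  vertex Fin.zero           (Fin.suc Fin.zero) Fin.zero           = subst 𝒮 (e₀₁₀ a d) s₁
  vertex Fin.zero           (Fin.suc Fin.zero) (Fin.suc Fin.zero) = subst 𝒮 (e₀₁₁ a d b) t₁
  vertex (Fin.suc Fin.zero) Fin.zero           Fin.zero           = subst 𝒮 (e₁₀₀ a d) s₁
  vertex (Fin.suc Fin.zero) Fin.zero           (Fin.suc Fin.zero) = subst 𝒮 (e₁₀₁ a d b) t₁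
  vertex (Fin.suc Fin.zero) (Fin.suc Fin.zero) Fin.zero           = subst 𝒮 (e₁₁₀ a d) s₂
  vertex (Fin.suc Fin.zero) (Fin.suc Fin.zero) (Fin.suc Fin.zero) = subst 𝒮 (e₁₁₁ a d b) t₂

two-progressions-admissible : ∀ {N n k n′ k′} → step n k ≡ step n′ k′ →
  1 ≤ step n k → side n′ k′ <ℕ side n k → large n k * large n k ≤ N →
  Coprime n k → Coprime k 2 →
  Admissible N (side n′ k′ * side n′ k′ , step n k , step n k ,
                side n k * side n k ∸ side n′ k′ * side n′ k′)
two-progressions-admissible {N} {n} {k} {n′} {k′} d≡d′ 1≤d A′<A C²≤N n⊥k k⊥2 =
  ≤-trans (m≤m+n a b) a+b≤N , (1≤d , d≤N) , (1≤d , d≤N) ,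
  (m<n⇒0<n∸m (*-mono-< A′<A A′<A) , ≤-trans (m≤n+m b a) a+b≤N) ,
  reduced ,
  two-progressions⇒H⊆𝒮
    (square∈𝒮 (side n′ k′) refl)
    (square∈𝒮 (middle n′ k′) a+d)
    (square∈𝒮 (large n′ k′) (trans (cong₂ _+_ a+d d≡d′) (sym (large²≡middle²+step n′ k′))))
    (square∈𝒮 (side n k) a+b)
    (square∈𝒮 (middle n k) a+b+d)
    (square∈𝒮 (large n k) a+b+d+d)
  where
  a = side n′ k′ * side n′ k′
  d = step n k
  b = side n k * side n k ∸ a

  a+d : a + d ≡ middle n′ k′ * middle n′ k′
  a+d = trans (cong (λ x → a + x) d≡d′) (sym (middle²≡side²+step n′ k′))

  a+b : a + b ≡ side n k * side n k
  a+b = m+[n∸m]≡n (*-mono-≤ (<⇒≤ A′<A) (<⇒≤ A′<A))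

  a+b+d : a + b + d ≡ middle n k * middle n k
  a+b+d = trans (cong (_+ d) a+b) (sym (middle²≡side²+step n k))

  a+b+d+d : a + b + d + d ≡ large n k * large n k
  a+b+d+d = trans (cong (_+ d) a+b+d) (sym (large²≡middle²+step n k))

  -- The largest vertex dominates every entry, so the bound on `large` alone controls all four.
  a+b+d+d≤N : a + b + d + d ≤ N
  a+b+d+d≤N = ≤-trans (≤-reflexive a+b+d+d) C²≤N

  a+b≤N : a + b ≤ N
  a+b≤N = m+n≤o⇒m≤o (a + b) (m+n≤o⇒m≤o (a + b + d) a+b+d+d≤N)

  d≤N : d ≤ N
  d≤N = m+n≤o⇒n≤o (a + b + d) a+b+d+d≤N

  reduced : Reduced a d d b
  reduced = middle²⊥step n⊥k k⊥2 (subst (g ∣_) a+b+d (∣m∣n⇒∣m+n (∣m∣n⇒∣m+n g∣a g∣b) g∣d) , g∣d)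
    where
    g = gcd a (gcd d (gcd d b))
    g∣a : g ∣ a
    g∣a = gcd[m,n]∣m a _
    g∣d : g ∣ d
    g∣d = ∣-trans (gcd[m,n]∣n a _) (gcd[m,n]∣m d _)
    g∣b : g ∣ b
    g∣b = ∣-trans (gcd[m,n]∣n a _) (∣-trans (gcd[m,n]∣n d _) (gcd[m,n]∣n d b))

-- Diophantus' triangles of equal area.

n₁ k₁ n₂ k₂ : ℕ → ℕ
n₁ u = u * (u + 2)
k₁ u = u + 3
n₂ u = 2 * u + 3
k₂ u = u * (u + 1)

-- Both sides equal 4u(u + 1)(u + 2)(u + 3)(2u + 3)(u² + 3u + 3). The quadratic factor is n + k in
-- both cases; 2n + k is (u + 1)(2u + 3) in the first and (u + 2)(u + 3) in the second.
step-agree : ∀ u → step (n₁ u) (k₁ u) ≡ step (n₂ u) (k₂ u)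
step-agree = identity
  where
  identity : ∀ u →
    4 * (u * (u + 2) * (u * (u + 2) + (u + 3))) * ((u + 3) * (2 * (u * (u + 2)) + (u + 3)))
    ≡ 4 * ((2 * u + 3) * (2 * u + 3 + u * (u + 1))) * (u * (u + 1) * (2 * (2 * u + 3) + u * (u + 1)))
  identity = solve-∀

-- The square of n = `n₁ u` separates the two: k ≤ n gives 2n² - k² ≥ n², while 2n′² and k′² both
-- stay below n².
side-increases : ∀ {u} → 4 ≤ u → side (n₂ u) (k₂ u) <ℕ side (n₁ u) (k₁ u)
side-increases {u} 4≤u = begin-strict
  side n′ k′                    ≤⟨ ∣m-n∣≤m⊔n (2 * (n′ * n′)) (k′ * k′) ⟩
  2 * (n′ * n′) ⊔ k′ * k′       <⟨ ⊔-pres-<m 2n′²<n² k′²<n² ⟩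
  n * n                         ≤⟨ m+n≤o⇒m≤o∸n (n * n) n²+k²≤2n² ⟩
  2 * (n * n) ∸ k * k           ≤⟨ m∸n≤∣m-n∣ (2 * (n * n)) (k * k) ⟩
  side n k                      ∎
  where
  open ≤-Reasoning
  n  = n₁ u
  k  = k₁ u
  n′ = n₂ u
  k′ = k₂ u

  3≤u : 3 ≤ u
  3≤u = ≤-trans (n≤1+n 3) 4≤u

  -- A linear lower bound for n suffices against k and n′, which are linear in u.
  3[u+2]≤n : 3 * (u + 2) ≤ n
  3[u+2]≤n = *-monoˡ-≤ (u + 2) 3≤u

  k≤n : k ≤ n
  k≤n = ≤-trans (≤-trans (m≤m+n (u + 3) (2 * u + 3)) (≤-reflexive (identity u))) 3[u+2]≤n
    where
    identity : ∀ u → u + 3 + (2 * u + 3) ≡ 3 * (u + 2)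
    identity = solve-∀

  n²+k²≤2n² : n * n + k * k ≤ 2 * (n * n)
  n²+k²≤2n² = +-monoʳ-≤ (n * n) (≤-trans (*-mono-≤ k≤n k≤n) (m≤m+n (n * n) 0))

  2n′²<n² : 2 * (n′ * n′) <ℕ n * n
  2n′²<n² = begin-strict
    2 * (n′ * n′)                              <⟨ m<m+n _ (m≤n⇒m≤o+n (u * u + 12 * u) (s≤s z≤n)) ⟩
    2 * (n′ * n′) + (u * u + 12 * u + 18)      ≡⟨ identity u ⟩
    3 * (u + 2) * (3 * (u + 2))                ≤⟨ *-mono-≤ 3[u+2]≤n 3[u+2]≤n ⟩
    n * n                                      ∎
    where
    identity : ∀ u → 2 * ((2 * u + 3) * (2 * u + 3)) + (u * u + 12 * u + 18)
                   ≡ 3 * (u + 2) * (3 * (u + 2))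
    identity = solve-∀

  k′<n : k′ <ℕ n
  k′<n = begin-strict
    u * (u + 1)        <⟨ m<m+n _ (≤-trans (s≤s z≤n) 4≤u) ⟩
    u * (u + 1) + u    ≡⟨ identity u ⟩
    u * (u + 2)        ∎
    where
    identity : ∀ u → u * (u + 1) + u ≡ u * (u + 2)
    identity = solve-∀

  k′²<n² : k′ * k′ <ℕ n * n
  k′²<n² = *-mono-< k′<n k′<n

-- `large` is at most (2(n + k))², and 2(n + k) is quadratic in u. The base 2(u + 2) is chosen to
-- become 12(s + 1) at u = 6s + 4.
large-bound : ∀ u → large (n₁ u) (k₁ u) * large (n₁ u) (k₁ u) ≤ (2 * (u + 2)) ^ 8
large-bound u = begin
  large n k * large n k                  ≤⟨ *-mono-≤ C≤y⁴ C≤y⁴ ⟩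
  y * y * (y * y) * (y * y * (y * y))    ≡⟨ eighth-power y ⟩
  y ^ 8                                  ∎
  where
  open ≤-Reasoning
  n = n₁ u
  k = k₁ u
  y = 2 * (u + 2)

  eighth-power : ∀ y → y * y * (y * y) * (y * y * (y * y))
                     ≡ y * (y * (y * (y * (y * (y * (y * (y * 1)))))))
  eighth-power = solve-∀

  2[n+k]≤y² : 2 * (n + k) ≤ y * y
  2[n+k]≤y² = ≤-trans (m≤m+n _ _) (≤-reflexive (identity u))
    where
    identity : ∀ u → 2 * (u * (u + 2) + (u + 3)) + (2 * u * u + 10 * u + 10)
                   ≡ 2 * (u + 2) * (2 * (u + 2))
    identity = solve-∀

  C≤y⁴ : large n k ≤ y * y * (y * y)
  C≤y⁴ = begin
    large n k                                                    ≤⟨ m≤m+n _ _ ⟩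
    large n k + (2 * (n * n) + 4 * (n * k) + 3 * (k * k))        ≡⟨ identity n k ⟩
    2 * (n + k) * (2 * (n + k))                                  ≤⟨ *-mono-≤ 2[n+k]≤y² 2[n+k]≤y² ⟩
    y * y * (y * y)                                              ∎
    where
    identity : ∀ n k → 2 * (n * n) + 4 * (n * k) + k * k + (2 * (n * n) + 4 * (n * k) + 3 * (k * k))
                     ≡ 2 * (n + k) * (2 * (n + k))
    identity = solve-∀

-- An injective family of reduced cubes.

step-mono-< : ∀ {n k n′ k′} → n <ℕ n′ → k <ℕ k′ → step n k <ℕ step n′ k′
step-mono-< n<n′ k<k′ =
  *-mono-< (*-monoʳ-< 4 (*-mono-< n<n′ (+-mono-< n<n′ k<k′)))
           (*-mono-< k<k′ (+-mono-< (*-monoʳ-< 2 n<n′) k<k′))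

-- This residue class makes k₁ coprime to 6, hence n₁ and k₁ coprime, and u ≥ 4.
parameter : ℕ → ℕ
parameter s = 6 * s + 4

k₁⊥2 : ∀ s → Coprime (k₁ (parameter s)) 2
k₁⊥2 s = subst (λ k → Coprime k 2) (identity s) (coprime-*+ (3 * s + 3) (Coprime.1-coprimeTo 2))
  where
  identity : ∀ s → (3 * s + 3) * 2 + 1 ≡ 6 * s + 4 + 3
  identity = solve-∀

k₁⊥3 : ∀ s → Coprime (k₁ (parameter s)) 3
k₁⊥3 s = subst (λ k → Coprime k 3) (identity s) (coprime-*+ (2 * s + 2) (Coprime.1-coprimeTo 3))
  where
  identity : ∀ s → (2 * s + 2) * 3 + 1 ≡ 6 * s + 4 + 3
  identity = solve-∀

-- Modulo u + 3 the product u(u + 2) is (-3)(-1) = 3, so a common divisor divides 3, to which `k₁`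
-- is coprime.
n₁⊥k₁ : ∀ s → Coprime (n₁ (parameter s)) (k₁ (parameter s))
n₁⊥k₁ s {d} (d∣n , d∣k) = k₁⊥3 s (d∣k , d∣3)
  where
  k = k₁ (parameter s)
  identity : ∀ u → u * (u + 2) + 4 * (u + 3) ≡ (u + 3) * (u + 3) + 3
  identity = solve-∀
  d∣3 : d ∣ 3
  d∣3 = ∣m+n∣m⇒∣n (subst (d ∣_) (identity (parameter s)) (∣m∣n⇒∣m+n d∣n (∣n⇒∣m*n 4 d∣k))) (∣n⇒∣m*n k d∣k)

cube : ℕ → Quadruple
cube s = x₂ * x₂ , d , d , x₁ * x₁ ∸ x₂ * x₂
  where
  x₁ = side (n₁ (parameter s)) (k₁ (parameter s))
  x₂ = side (n₂ (parameter s)) (k₂ (parameter s))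
  d  = step (n₁ (parameter s)) (k₁ (parameter s))

edge-mono-< : ∀ {s t} → s <ℕ t →
  step (n₁ (parameter s)) (k₁ (parameter s)) <ℕ step (n₁ (parameter t)) (k₁ (parameter t))
edge-mono-< s<t = step-mono-< (*-mono-< params< (+-monoˡ-< 2 params<)) (+-monoˡ-< 3 params<)
  where params< = +-monoˡ-< 4 (*-monoʳ-< 6 s<t)

-- The entry a₁ = d already separates the cubes, since it grows strictly with the parameter.
cube-injective : ∀ {s t} → cube s ≡ cube t → s ≡ t
cube-injective {s} {t} eq with <-cmp s t
... | tri< s<t _ _ = contradiction (cong (proj₁ ∘ proj₂) eq) (<⇒≢ (edge-mono-< s<t))
... | tri≈ _ s≡t _ = s≡t
... | tri> _ _ t<s = contradiction (sym (cong (proj₁ ∘ proj₂) eq)) (<⇒≢ (edge-mono-< t<s))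

cube-admissible : ∀ {N} s → (12 * suc s) ^ 8 ≤ N → Admissible N (cube s)
cube-admissible {N} s bound = two-progressions-admissible
  {n = n₁ (parameter s)} {k₁ (parameter s)} {n₂ (parameter s)} {k₂ (parameter s)}
  (step-agree (parameter s))
  -- Positivity is strict monotonicity started from `step 0 0`, which is 0.
  (≤-trans (s≤s z≤n) (step-mono-< {0} {0} n>0 (m≤n⇒m≤o+n (parameter s) (s≤s z≤n))))
  (side-increases (m≤n+m 4 (6 * s)))
  (≤-trans (large-bound (parameter s)) (subst (λ y → y ^ 8 ≤ N) (identity s) bound))
  (n₁⊥k₁ s) (k₁⊥2 s)
  where
  n>0 : 0 <ℕ n₁ (parameter s)
  n>0 = *-mono-< {0} {parameter s} {0} (m≤n⇒m≤o+n (6 * s) (s≤s z≤n)) (m≤n⇒m≤o+n (parameter s) (s≤s z≤n))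
  identity : ∀ s → 12 * (1 + s) ≡ 2 * (6 * s + 4 + 2)
  identity = solve-∀

-- Counting the cubes up to N.

-- Each s below n is sent to a position of `f s` in `xs`. Equal positions hold equal values, so this
-- is an injection between finite sets.
injection⇒≤length : ∀ {A : Set} {n} {xs : List A} (f : ℕ → A) →
  (∀ {s t} → f s ≡ f t → s ≡ t) → (∀ {s} → s <ℕ n → f s ∈ xs) → n ≤ length xs
injection⇒≤length {n = n} {xs} f f-injective f∈xs = Fin.injective⇒≤ position-injective
  where
  f∈ : (i : Fin n) → f (toℕ i) ∈ xs
  f∈ i = f∈xs (toℕ<n i)
  position-injective : ∀ {i j} → index (f∈ i) ≡ index (f∈ j) → i ≡ j
  position-injective {i} {j} eq = toℕ-injective (f-injective
    (trans (lookup-index (f∈ i)) (trans (cong (lookup xs) eq) (sym (lookup-index (f∈ j))))))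

admissible⇒∈box : ∀ {N q} → Admissible N q → q ∈ box N
admissible⇒∈box (a₀≤N , (_ , a₁≤N) , (_ , a₂≤N) , (_ , a₃≤N) , _) =
  ∈-cartesianProduct⁺ (∈-upTo⁺ (s≤s a₀≤N))
    (∈-cartesianProduct⁺ (∈-upTo⁺ (s≤s a₁≤N))
      (∈-cartesianProduct⁺ (∈-upTo⁺ (s≤s a₂≤N)) (∈-upTo⁺ (s≤s a₃≤N))))

n≤H₃ : ∀ n N → (12 * n) ^ 8 ≤ N → n ≤ H₃ N
n≤H₃ n N [12n]⁸≤N = injection⇒≤length cube cube-injective λ {s} s<n →
  let adm = cube-admissible s (≤-trans (^-monoˡ-≤ 8 (*-monoʳ-≤ 12 s<n)) [12n]⁸≤N)
  in ∈-filter⁺ (Admissible? N) (admissible⇒∈box adm) adm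

-- For f n = (12n)⁸ this yields the integer part of N^(1/8)/12 without real roots. In the induction
-- on N, n advances exactly when N + 1 reaches the next value of f.
floor-inverse : ∀ (f : ℕ → ℕ) → f 0 ≡ 0 → (∀ n → f n <ℕ f (suc n)) →
  ∀ N → ∃[ n ] f n ≤ N × N <ℕ f (suc n)
floor-inverse f f0≡0 f< zero = 0 , ≤-reflexive f0≡0 , subst (_<ℕ f 1) f0≡0 (f< 0)
floor-inverse f f0≡0 f< (suc N) with floor-inverse f f0≡0 f< N
... | n , fn≤N , N<f with m≤n⇒m<n∨m≡n N<f
...   | inj₁ 1+N<f = n , m≤n⇒m≤1+n fn≤N , 1+N<f
...   | inj₂ 1+N≡f = suc n , ≤-reflexive (sym 1+N≡f) , subst (_<ℕ f (2 + n)) (sym 1+N≡f) (f< (suc n))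

-- Rounding down costs at most a factor 2, as n + 1 ≤ 2n for n ≥ 1; this turns 12 into 24. The bound
-- 12⁸ ≤ N excludes n = 0.
N≤[24H₃]⁸ : ∀ N → 12 ^ 8 ≤ N → N ≤ (24 * H₃ N) ^ 8
N≤[24H₃]⁸ N 12⁸≤N with floor-inverse (λ n → (12 * n) ^ 8) refl (λ n →
     ^-monoˡ-< 8 {12 * n} {12 * suc n} (*-monoʳ-< 12 (n<1+n n))) N
... | zero  , _     , N<12⁸ = contradiction 12⁸≤N (<⇒≱ N<12⁸)
... | suc m , lower , upper = begin
  N                       ≤⟨ <⇒≤ upper ⟩
  (12 * suc (suc m)) ^ 8  ≤⟨ ^-monoˡ-≤ 8 12[2+m]≤24[1+m] ⟩
  (24 * suc m) ^ 8        ≤⟨ ^-monoˡ-≤ 8 (*-monoʳ-≤ 24 (n≤H₃ (suc m) N lower)) ⟩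
  (24 * H₃ N) ^ 8         ∎
  where
  open ≤-Reasoning
  identity : ∀ m → 12 * (2 + m) + 12 * m ≡ 24 * (1 + m)
  identity = solve-∀
  12[2+m]≤24[1+m] : 12 * suc (suc m) ≤ 24 * suc m
  12[2+m]≤24[1+m] = ≤-trans (m≤m+n _ _) (≤-reflexive (identity m))

-- Passage to eighth powers of rationals.

-- `fromℕ` reduces to lowest terms by a gcd, which is stuck on a variable; the unnormalised fraction
-- n/1 makes order and products accessible.
fromℕ-≃ : ∀ n → ℚ.toℚᵘ (fromℕ n) ℚᵘ.≃ ℚᵘ.mkℚᵘ (+ n) 0
fromℕ-≃ n = ℚ.toℚᵘ-fromℚᵘ (ℚᵘ.mkℚᵘ (+ n) 0)

fromℕ-mono-≤ : ∀ {m n} → m ≤ n → fromℕ m ℚ.≤ fromℕ n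
fromℕ-mono-≤ {m} {n} m≤n = ℚ.toℚᵘ-cancel-≤
  (ℚᵘ.≤-respˡ-≃ (ℚᵘ.≃-sym (fromℕ-≃ m)) (ℚᵘ.≤-respʳ-≃ (ℚᵘ.≃-sym (fromℕ-≃ n))
    (ℚᵘ.*≤* (ℤ.*-monoʳ-≤-nonNeg (+ 1) (ℤ.+≤+ m≤n)))))

fromℕ-homo-* : ∀ m n → fromℕ (m * n) ≡ fromℕ m ℚ.* fromℕ n
fromℕ-homo-* m n = ℚ.toℚᵘ-injective (begin
  ℚ.toℚᵘ (fromℕ (m * n))                        ≈⟨ fromℕ-≃ (m * n) ⟩
  ℚᵘ.mkℚᵘ (+ (m * n)) 0                         ≡⟨ cong (λ i → ℚᵘ.mkℚᵘ i 0) (ℤ.pos-* m n) ⟩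
  ℚᵘ.mkℚᵘ (+ m) 0 ℚᵘ.* ℚᵘ.mkℚᵘ (+ n) 0          ≈⟨ ℚᵘ.*-cong (fromℕ-≃ m) (fromℕ-≃ n) ⟨
  ℚ.toℚᵘ (fromℕ m) ℚᵘ.* ℚ.toℚᵘ (fromℕ n)        ≈⟨ ℚ.toℚᵘ-homo-* (fromℕ m) (fromℕ n) ⟨
  ℚ.toℚᵘ (fromℕ m ℚ.* fromℕ n)                  ∎)
  where open ℚᵘ.≃-Reasoning

fromℕ-homo-^ : ∀ m k → fromℕ (m ^ k) ≡ fromℕ m ℚ-Power.^ k
fromℕ-homo-^ m zero    = refl
fromℕ-homo-^ m (suc k) = trans (fromℕ-homo-* m (m ^ k)) (cong (fromℕ m ℚ.*_) (fromℕ-homo-^ m k))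

1/24 : ℚ
1/24 = + 1 ℚ./ 24

N≤[24h]⁸⇒1/24·N^[1/8]≤h : ∀ N h → N ≤ (24 * h) ^ 8 → 1/24 · N ^[1/ 8 ]≤ h
N≤[24h]⁸⇒1/24·N^[1/8]≤h N h N≤[24h]⁸ = begin
  1/24 ℚ-Power.^ 8 ℚ.* fromℕ N                        ≤⟨ ℚ.*-monoˡ-≤-nonNeg (1/24 ℚ-Power.^ 8) (fromℕ-mono-≤ N≤[24h]⁸) ⟩
  1/24 ℚ-Power.^ 8 ℚ.* fromℕ ((24 * h) ^ 8)           ≡⟨ cong (1/24 ℚ-Power.^ 8 ℚ.*_) (fromℕ-homo-^ (24 * h) 8) ⟩
  1/24 ℚ-Power.^ 8 ℚ.* fromℕ (24 * h) ℚ-Power.^ 8     ≡⟨ ℚ-Exp.^-distrib-* 1/24 (fromℕ (24 * h)) 8 ⟨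
  (1/24 ℚ.* fromℕ (24 * h)) ℚ-Power.^ 8               ≡⟨ cong (ℚ-Power._^ 8) 1/24*24h≡h ⟩
  fromℕ h ℚ-Power.^ 8                                 ∎
  where
  open ℚ.≤-Reasoning
  1/24*24h≡h : 1/24 ℚ.* fromℕ (24 * h) ≡ fromℕ h
  1/24*24h≡h = trans (cong (1/24 ℚ.*_) (fromℕ-homo-* 24 h))
    -- The product of `1/24` and `fromℕ 24` evaluates to 1.
    (trans (sym (ℚ.*-assoc 1/24 (fromℕ 24) (fromℕ h))) (ℚ.*-identityˡ (fromℕ h)))

theorem1p5 : ∃[ c ] (0ℚ < c × ∃[ N₀ ] ((N : ℕ) → 1 ≤ N → N₀ ≤ N → c · N ^[1/ 8 ]≤ H₃ N))
theorem1p5 = 1/24 , ℚ.positive⁻¹ 1/24 , 12 ^ 8 , λ N _ 12⁸≤N →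
  N≤[24h]⁸⇒1/24·N^[1/8]≤h N (H₃ N) (N≤[24H₃]⁸ N 12⁸≤N)
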